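{- For any graph class $\mathcal{C}$ the following are equivalent: (i) $\mathcal{C}$ has bounded expansion; (ii) for every $r \in \mathbb{N}$ there exists $m\in\mathbb{N}$ such that every vertex of every graph in $\mathcal{C}$ has finite $(r,m)$-rank (i.e. $(r,m)$-rank not equal to $\infty$).
   Context: Bounded expansion is in the sense of Nešetřil and Ossona de Mendez. Graphs are finite and simple. $N_r^G(v)$ is the closed $r$-neighborhood of $v$ (vertices reachable from $v$ by a path with at most $r$ edges, including $v$); $G-S$ is the subgraph induced on $V(G)\setminus S$. The $(r,m)$-rank of vertices of $G$ (values in $\mathbb{N}\cup\{\infty\}$) is defined by the following procedure: initially every vertex has rank $\infty$; in rounds $i=1,2,3,\dots$, every vertex $v$ that currently has rank $\infty$ receives rank $i$ if there exists a set $S\subseteq V(G)\setminus\{v\}$ with $|S|\le m$ such that every vertex of $N_r^{G-S}(v)\setminus\{v\}$ received a finite rank in rounds $1,\dots,i-1$ (all vertices are checked simultaneously in a round); the procedure stops when all vertices have finite rank or a round assigns no new rank. Vertices still of rank $\infty$ keep rank $\infty$. -}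

module Defs where

open import Data.Bool.Base using (if_then_else_)
open import Data.Fin.Base as Fin using (Fin)
open import Data.Fin.Properties as Fin using (any?; all?)
open import Data.Fin.Subset using (Subset; _∈_; _∉_; _⊂_; ∣_∣; ∁)
open import Data.Fin.Subset.Properties using (_∈?_; anySubset?; p⊂q⇒∣p∣<∣q∣; ∣p∣≤n; ∣p∣≡n⇒p≡⊤; ∈⊤)
open import Data.List.Base using (List; []; _∷_; length; filter; allFin; cartesianProduct)
open import Data.List.Relation.Unary.All as All using (All)
open import Data.List.Relation.Unary.AllPairs using (allPairs?)
open import Data.List.Relation.Unary.Unique.Propositional using (Unique)
open import Data.Nat.Base using (ℕ; zero; suc; _*_; _≤_; s≤s; z≤n; _≤′_; ≤′-refl; ≤′-step)
open import Data.Nat.Properties using (_≤?_; ≤-trans; ≤-antisym; ≤⇒≤′; ≤-refl; m≤n⇒m≤1+n; m<1+n⇒m<n∨m≡n)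
open import Data.Product.Base using (∃; ∃-syntax; _×_; _,_)
open import Data.Sum.Base using (_⊎_; inj₁; inj₂)
open import Data.Vec.Base using (tabulate)
open import Data.Vec.Properties using (lookup∘tabulate; []=⇒lookup; lookup⇒[]=)
open import Level using (0ℓ; _⊔_) renaming (suc to lsuc)
open import Relation.Binary.Core using (Rel)
open import Relation.Binary.Definitions using (Decidable; Symmetric)
open import Relation.Binary.PropositionalEquality using (_≡_; _≢_; refl; sym; trans; subst)
open import Relation.Nullary.Decidable using (Dec; yes; no; does; map′; ¬?; _×-dec_; _→-dec_; dec-true)
open import Relation.Nullary.Negation using (¬_; contradiction)
open import Relation.Unary using (Pred)

record Graph : Set₁ where
  field
    order     : ℕ
  Vertex : Set
  Vertex = Fin order
  field
    Adj       : Rel Vertex 0ℓ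
    adj?      : Decidable Adj
    symmetric : Symmetric Adj
    loopless  : ∀ {v} → ¬ Adj v v

open Graph public using (order; Vertex)

-- Each edge is listed once, as the pair of its endpoints in increasing order.
edges : (G : Graph) → List (Vertex G × Vertex G)
edges G = filter (λ (u , v) → (u Fin.<? v) ×-dec Graph.adj? G u v)
                 (cartesianProduct (allFin (order G)) (allFin (order G)))

size : Graph → ℕ
size G = length (edges G)

data Walk (G : Graph) : Vertex G → Vertex G → ℕ → Set where
  stop : ∀ {v} → Walk G v v 0
  step : ∀ {u v w k} → Graph.Adj G u v → Walk G v w k → Walk G u w (suc k)

vertices : ∀ {G u w k} → Walk G u w k → List (Vertex G)
vertices {u = u} stop       = u ∷ []
vertices {u = u} (step _ p) = u ∷ vertices p

-- For A ⊆ V(G): a path with k edges in the induced subgraph G[A].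
Path : (G : Graph) → Subset (order G) → Vertex G → Vertex G → ℕ → Set
Path G A u w k = ∃[ p ] (Unique (vertices {G} {u} {w} {k} p) × All (_∈ A) (vertices p))

-- w ∈ N_r^{G[A]}(v).
InBall : (G : Graph) → Subset (order G) → ℕ → Vertex G → Vertex G → Set
InBall G A r v w = ∃[ k ] (k ≤ r × Path G A v w k)

walk? : ∀ G {P : Pred (List (Vertex G)) 0ℓ} → (∀ xs → Dec (P xs)) →
        ∀ u w k → Dec (∃[ p ] P (vertices {G} {u} {w} {k} p))
walk? G {P} P? u w zero with u Fin.≟ w
... | no u≢w   = no λ { (stop , _) → u≢w refl }
... | yes refl = map′ (stop ,_) (λ { (stop , Pp) → Pp }) (P? (u ∷ []))
walk? G P? u w (suc k) =
  map′ (λ { (_ , a , p , Pp) → step a p , Pp }) (λ { (step a p , Pp) → _ , a , p , Pp })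
       (any? λ v → Graph.adj? G u v ×-dec walk? G (λ xs → P? (u ∷ xs)) v w k)

path? : ∀ G A u w k → Dec (Path G A u w k)
path? G A u w k =
  walk? G (λ xs → allPairs? (λ x y → ¬? (x Fin.≟ y)) xs ×-dec All.all? (_∈? A) xs) u w k

inBall? : ∀ G A r v w → Dec (InBall G A r v w)
inBall? G A zero v w = map′ (λ p → 0 , z≤n , p) (λ { (_ , z≤n , p) → p }) (path? G A v w 0)
inBall? G A (suc r) v w with path? G A v w (suc r) | inBall? G A r v w
... | yes p | _                 = yes (suc r , ≤-refl , p)
... | no _  | yes (k , k≤r , p) = yes (k , m≤n⇒m≤1+n k≤r , p)
... | no ¬p | no ¬q             = no λ { (k , k≤1+r , p) → absurd k≤1+r p }
  where
  absurd : ∀ {k} → k ≤ suc r → ¬ Path G A v w k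
  absurd k≤1+r p with m<1+n⇒m<n∨m≡n (s≤s k≤1+r)
  ... | inj₁ (s≤s k≤r) = ¬q (_ , k≤r , p)
  ... | inj₂ refl      = ¬p p

-- H is a shallow minor of G at depth r: H is a subgraph of the graph obtained
-- from G by contracting disjoint vertex sets, each inducing a subgraph of
-- radius at most r, and deleting the vertices outside these sets.
record ShallowMinor (r : ℕ) (H G : Graph) : Set where
  field
    branch   : Vertex H → Subset (order G)
    disjoint : ∀ {x y v} → v ∈ branch x → v ∈ branch y → x ≡ y
    centre   : Vertex H → Vertex G
    centre∈  : ∀ x → centre x ∈ branch x
    radius   : ∀ x {v} → v ∈ branch x → InBall G (branch x) r (centre x) v
    edge     : ∀ {x y} → Graph.Adj H x y →
               ∃[ u ] ∃[ v ] (u ∈ branch x × v ∈ branch y × Graph.Adj G u v)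

-- |E(H)| / |V(H)| ≤ f r, multiplied out so as to make sense for the empty H;
-- a real-valued bound f may be replaced by its ceiling.
BoundedExpansion : ∀ {ℓ} → Pred Graph ℓ → Set (lsuc 0ℓ ⊔ ℓ)
BoundedExpansion C =
  ∃ λ (f : ℕ → ℕ) → ∀ r G → C G → ∀ H → ShallowMinor r H G → size H ≤ f r * order H

data ℕ∞ : Set where
  fin : ℕ → ℕ∞
  ∞   : ℕ∞

_≟∞ : (x : ℕ∞) → Dec (x ≡ ∞)
fin _ ≟∞ = no λ ()
∞     ≟∞ = yes refl

module _ (G : Graph) (r m : ℕ) where

  Ranking : Set
  Ranking = Vertex G → ℕ∞

  Eligible : Ranking → Vertex G → Set
  Eligible ρ v = ∃[ S ] (v ∉ S × ∣ S ∣ ≤ m ×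
                         (∀ w → InBall G (∁ S) r v w → w ≢ v → ρ w ≢ ∞))

  eligible? : ∀ ρ v → Dec (Eligible ρ v)
  eligible? ρ v = anySubset? λ S →
    ¬? (v ∈? S) ×-dec (∣ S ∣ ≤? m) ×-dec
    all? λ w → inBall? G (∁ S) r v w →-dec ¬? (w Fin.≟ v) →-dec ¬? (ρ w ≟∞)

  -- Round i, given the ranking produced by the preceding rounds.
  round : ℕ → Ranking → Ranking
  round i ρ v with ρ v
  ... | fin j = fin j
  ... | ∞     = if does (eligible? ρ v) then fin i else ∞

  ranksAfter : ℕ → Ranking
  ranksAfter zero    _ = ∞
  ranksAfter (suc i)   = round (suc i) (ranksAfter i)

  -- Every round before the procedure stops ranks a new vertex, so |V(G)|
  -- rounds suffice; rank-final below shows that later rounds change nothing.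
  rank : Vertex G → ℕ∞
  rank = ranksAfter (order G)

  private
    Stable : ℕ → Set
    Stable k = ∀ v → ranksAfter k v ≡ ∞ → ranksAfter (suc k) v ≡ ∞

    stable? : ∀ k → Dec (Stable k)
    stable? k = all? λ v → (ranksAfter k v ≟∞) →-dec (ranksAfter (suc k) v ≟∞)

    round-fin : ∀ i ρ {v j} → ρ v ≡ fin j → round i ρ v ≡ fin j
    round-fin i ρ {v} eq with ρ v
    round-fin i ρ {v} refl | fin j = refl

    round-∞⁻ : ∀ i ρ {v} → round i ρ v ≡ ∞ → ρ v ≡ ∞ × ¬ Eligible ρ v
    round-∞⁻ i ρ {v} eq with ρ v
    round-∞⁻ i ρ {v} eq | ∞ with eligible? ρ v
    round-∞⁻ i ρ {v} eq | ∞ | no ¬e = refl , ¬e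

    round-∞⁺ : ∀ i ρ {v} → ρ v ≡ ∞ → ¬ Eligible ρ v → round i ρ v ≡ ∞
    round-∞⁺ i ρ {v} eq ¬e with ρ v
    round-∞⁺ i ρ {v} eq ¬e | ∞ with eligible? ρ v
    ... | yes e = contradiction e ¬e
    ... | no _  = refl

    stable-suc : ∀ k → Stable k → Stable (suc k)
    stable-suc k st v eq with round-∞⁻ (suc k) (ranksAfter k) eq
    ... | _ , ¬e = round-∞⁺ (suc (suc k)) (ranksAfter (suc k)) eq
      λ { (S , v∉S , ∣S∣≤m , h) → ¬e (S , v∉S , ∣S∣≤m ,
          λ w w∈N w≢v ρw≡∞ → h w w∈N w≢v (st w ρw≡∞)) }

    stable⇒≡ : ∀ k → Stable k → ∀ v → ranksAfter (suc k) v ≡ ranksAfter k v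
    stable⇒≡ k st v = go (ranksAfter k v) refl
      where
      go : ∀ x → ranksAfter k v ≡ x → ranksAfter (suc k) v ≡ ranksAfter k v
      go (fin j) eq = trans (round-fin (suc k) (ranksAfter k) eq) (sym eq)
      go ∞       eq = trans (st v eq) (sym eq)

    ranked : ℕ → Subset (order G)
    ranked k = tabulate λ v → does (¬? (ranksAfter k v ≟∞))

    ranked⁺ : ∀ k {v} → ranksAfter k v ≢ ∞ → v ∈ ranked k
    ranked⁺ k {v} ≢∞ = lookup⇒[]= v _
      (trans (lookup∘tabulate _ v) (dec-true (¬? (ranksAfter k v ≟∞)) ≢∞))

    ranked⁻ : ∀ k {v} → v ∈ ranked k → ranksAfter k v ≢ ∞
    ranked⁻ k {v} v∈ with ranksAfter k v | trans (sym (lookup∘tabulate (λ v → does (¬? (ranksAfter k v ≟∞))) v)) ([]=⇒lookup v∈)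
    ... | fin _ | _ = λ ()

    grows : ∀ k → ¬ Stable k → ranked k ⊂ ranked (suc k)
    grows k ¬st with Fin.¬∀⟶∃¬ (order G) _ (λ v → (ranksAfter k v ≟∞) →-dec (ranksAfter (suc k) v ≟∞)) ¬st
    ... | v , ¬h =
      (λ x∈ → ranked⁺ (suc k) λ eq →
        let (eq′ , _) = round-∞⁻ (suc k) (ranksAfter k) eq in ranked⁻ k x∈ eq′) ,
      v , ranked⁺ (suc k) (λ eq → ¬h λ _ → eq) ,
      λ v∈ → ¬h λ eq → contradiction eq (ranked⁻ k v∈)

    progress : ∀ k → Stable k ⊎ k ≤ ∣ ranked k ∣
    progress zero = inj₂ z≤n
    progress (suc k) with stable? k | progress k
    ... | yes st | _        = inj₁ (stable-suc k st)
    ... | no ¬st | inj₁ st  = contradiction st ¬st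
    ... | no ¬st | inj₂ k≤  = inj₂ (≤-trans (s≤s k≤) (p⊂q⇒∣p∣<∣q∣ (grows k ¬st)))

    stable-order : Stable (order G)
    stable-order with progress (order G)
    ... | inj₁ st = st
    ... | inj₂ n≤ = λ v eq → contradiction eq (ranked⁻ (order G)
      (subst (v ∈_) (sym (∣p∣≡n⇒p≡⊤ (≤-antisym (∣p∣≤n (ranked (order G))) n≤))) ∈⊤))

    final : ∀ {k} → order G ≤′ k → Stable k × (∀ v → ranksAfter k v ≡ rank v)
    final ≤′-refl = stable-order , λ _ → refl
    final (≤′-step {k} n≤k) with final n≤k
    ... | st , eq = stable-suc k st , λ v → trans (stable⇒≡ k st v) (eq v)

  rank-final : ∀ {k} → order G ≤ k → ∀ v → ranksAfter k v ≡ rank v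
  rank-final n≤k v = let (_ , eq) = final (≤⇒≤′ n≤k) in eq v

{-# OPTIONS --safe #-}
module Submission where

-- Finite rank ⇒ sparse minors.  Every vertex v has a separator of size at most
-- m cutting it off from the vertices of rank at least its own.  Following
-- separators k times from v yields boundedly many vertices, among them each u
-- that has maximum rank on some walk of length k from v.  Pick a vertex of
-- maximum rank in every branch set of a shallow minor H; for an edge of H, the
-- higher of the two vertices is found in this way from the lower one, so the
-- edges of H are charged to its vertices.
--
-- Sparse minors ⇒ finite rank.  Let U be the set of unranked vertices.  Take a
-- maximal family of short, internally disjoint paths joining distinct pairs of
-- U, at most one path for each pair, and let M be the vertices on them.
-- Contracting the halves of the paths shows that there are O(|U|) of them, so
-- |M| = O(|U|), and that a constant fraction R of U is pairwise unjoined.  By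
-- maximality the r-balls around the vertices of R in the graph without M ∪ U
-- are disjoint.  The neighbours of such a ball in M ∪ U separate its centre
-- from U, so there are more than m of them; contracting the balls then gives a
-- minor with more than m|R| edges and O(|U|) = O(|R|) vertices.

open import Defs
open import Data.Bool.Base using (true; false)
open import Data.Fin.Base as Fin using (Fin; zero; suc)
open import Data.Fin.Properties as Fin using (any?; injective⇒≤)
open import Data.Fin.Subset using (Subset; inside; outside; ∣_∣; ∁) renaming (_∈_ to _∈ˢ_; _∉_ to _∉ˢ_)
open import Data.Fin.Subset.Properties using (x∈∁p⇒x∉p; x∉p⇒x∈∁p) renaming (_∈?_ to _∈ˢ?_)
open import Data.List.Base
  using (List; []; _∷_; _++_; length; filter; map; concatMap; lookup; allFin; cartesianProduct; deduplicate)
open import Data.List.Extrema.Nat using (argmax; argmax-all; f[xs]≤f[argmax])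
import Data.List.Membership.DecPropositional as DecMembership
open import Data.List.Membership.Propositional using (_∈_; _∉_; find; lose)
open import Data.List.Membership.Propositional.Properties
  using (∈-map⁺; ∈-map⁻; ∈-++⁺ˡ; ∈-++⁺ʳ; ∈-++⁻; ∈-concatMap⁺;
         ∈-cartesianProduct⁺; ∈-cartesianProduct⁻; ∈-filter⁺; ∈-filter⁻;
         ∈-deduplicate⁺; ∈-deduplicate⁻; ∈-lookup; ∈-length; ∈-allFin)
open import Data.List.Membership.Setoid.Properties using (index-injective)
open import Data.List.Properties
  using (length-map; length-++; filter-++; filter-notAll; length-deduplicate; length-tabulate)
open import Data.List.Relation.Binary.Subset.Propositional using (_⊆_)
open import Data.List.Relation.Unary.All as All using (All; []; _∷_)
open import Data.List.Relation.Unary.All.Properties using (¬Any⇒All¬)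
open import Data.List.Relation.Unary.AllPairs using ([]; _∷_)
open import Data.List.Relation.Unary.Any as Any using (Any; here; there)
open import Data.List.Relation.Unary.Any.Properties using (lookup-index)
open import Data.List.Relation.Unary.Unique.Propositional using (Unique)
import Data.List.Relation.Unary.Unique.Propositional.Properties as Unique
import Data.List.Relation.Unary.Unique.DecPropositional.Properties as DecUnique
open import Data.Nat.Base using (ℕ; zero; suc; pred; _+_; _*_; _≤_; _<_; z≤n; s≤s)
open import Data.Nat.Properties
open import Data.Nat.Tactic.RingSolver using (solve-∀)
open import Data.Product.Base using (∃-syntax; Σ-syntax; _×_; _,_; proj₁; proj₂; swap; uncurry)
open import Data.Product.Properties using (≡-dec; ,-injective)
open import Data.Sum.Base using (_⊎_; inj₁; inj₂; [_,_])
open import Data.Vec.Base using (tabulate; here; there; []; _∷_)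
open import Data.Vec.Properties using (lookup∘tabulate; []=⇒lookup; lookup⇒[]=)
open import Function.Base using (_∘_; id)
open import Function.Bundles using (_⇔_; mk⇔)
open import Level using (Level; 0ℓ)
open import Relation.Binary.Core using (Rel)
open import Relation.Binary.Definitions using (DecidableEquality; tri<; tri≈; tri>)
  renaming (Decidable to Decidable₂; Symmetric to Symmetric₂)
open import Relation.Binary.PropositionalEquality using (_≡_; _≢_; refl; sym; trans; cong; subst; setoid)
open import Relation.Nullary.Decidable
  using (Dec; yes; no; does; map′; ¬?; _×-dec_; _⊎-dec_; dec-true; decidable-stable)
open import Relation.Nullary.Negation using (¬_; contradiction)
open import Relation.Unary using (Pred; Decidable)

private variable
  A B : Set
  n : ℕ

-- Counting in lists

lookup-injective : {xs : List A} → Unique xs → ∀ i j → lookup xs i ≡ lookup xs j → i ≡ j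
lookup-injective (_ ∷ _)   zero    zero    _  = refl
lookup-injective (x∉ ∷ _)  zero    (suc j) eq = contradiction eq (All.lookup x∉ (∈-lookup j))
lookup-injective (x∉ ∷ _)  (suc i) zero    eq = contradiction (sym eq) (All.lookup x∉ (∈-lookup i))
lookup-injective (_ ∷ xs!) (suc i) (suc j) eq = cong suc (lookup-injective xs! i j eq)

injection⇒length≤ : {xs : List A} {ys : List B} (f : A → B) → Unique xs →
  (∀ {x} → x ∈ xs → f x ∈ ys) → (∀ {x y} → x ∈ xs → y ∈ xs → f x ≡ f y → x ≡ y) →
  length xs ≤ length ys
injection⇒length≤ {xs = xs} f xs! f∈ f-inj =
  injective⇒≤ {f = λ i → Any.index (f∈ (∈-lookup {xs = xs} i))} λ {i} {j} eq →
    lookup-injective xs! i j (f-inj (∈-lookup i) (∈-lookup j)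
      (index-injective (setoid _) (f∈ (∈-lookup i)) (f∈ (∈-lookup j)) eq))

unique-⊆⇒length≤ : {xs ys : List A} → Unique xs → xs ⊆ ys → length xs ≤ length ys
unique-⊆⇒length≤ xs! xs⊆ys = injection⇒length≤ id xs! xs⊆ys (λ _ _ eq → eq)

length-filter-map : (f : A → B) {P : Pred B 0ℓ} (P? : Decidable P) → ∀ xs →
                    length (filter P? (map f xs)) ≡ length (filter (P? ∘ f) xs)
length-filter-map f P? []       = refl
length-filter-map f P? (x ∷ xs) with does (P? (f x))
... | true  = cong suc (length-filter-map f P? xs)
... | false = length-filter-map f P? xs

-- The lower half of two double counts: one of degrees, one of the exits of disjoint balls.
length-filter-product : {Q : Pred (A × B) 0ℓ} (Q? : Decidable Q) {k : ℕ} (xs : List A) (ys : List B) →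
  (∀ {x} → x ∈ xs → k ≤ length (filter (λ y → Q? (x , y)) ys)) →
  length xs * k ≤ length (filter Q? (cartesianProduct xs ys))
length-filter-product Q? []       ys k≤ = z≤n
length-filter-product Q? {k} (x ∷ xs) ys k≤ = begin
  k + length xs * k
    ≤⟨ +-mono-≤ (k≤ (here refl)) (length-filter-product Q? xs ys (k≤ ∘ there)) ⟩
  length (filter (λ y → Q? (x , y)) ys) + length (filter Q? (cartesianProduct xs ys))
    ≡⟨ cong (_+ _) (length-filter-map (x ,_) Q? ys) ⟨
  length (filter Q? (map (x ,_) ys)) + length (filter Q? (cartesianProduct xs ys))
    ≡⟨ length-++ (filter Q? (map (x ,_) ys)) ⟨
  length (filter Q? (map (x ,_) ys) ++ filter Q? (cartesianProduct xs ys))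
    ≡⟨ cong length (filter-++ Q? (map (x ,_) ys) (cartesianProduct xs ys)) ⟨
  length (filter Q? (cartesianProduct (x ∷ xs) ys)) ∎
  where open ≤-Reasoning

length-concatMap-≤ : (f : A → List B) {k : ℕ} → (∀ x → length (f x) ≤ k) →
                     ∀ xs → length (concatMap f xs) ≤ length xs * k
length-concatMap-≤ f f≤ []       = z≤n
length-concatMap-≤ f {k} f≤ (x ∷ xs) = begin
  length (f x ++ concatMap f xs)        ≡⟨ length-++ (f x) ⟩
  length (f x) + length (concatMap f xs) ≤⟨ +-mono-≤ (f≤ x) (length-concatMap-≤ f f≤ xs) ⟩
  k + length xs * k                     ∎
  where open ≤-Reasoning

++⁻-disjoint : ∀ {x : A} xs {ys} → Unique (xs ++ ys) → x ∈ xs → x ∉ ys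
++⁻-disjoint (_ ∷ xs) (x∉ ∷ _) (here refl) x∈ys = All.lookup x∉ (∈-++⁺ʳ xs x∈ys) refl
++⁻-disjoint (_ ∷ xs) (_ ∷ !) (there x∈xs) x∈ys = ++⁻-disjoint xs ! x∈xs x∈ys

-- Independent sets in sparse relations

module _ (_≟_ : DecidableEquality A) {R : Rel A 0ℓ} (R? : Decidable₂ R) (R-sym : Symmetric₂ R) (k : ℕ)
  where

  private
    pairs : List A → List (A × A)
    pairs W = filter (uncurry R?) (cartesianProduct W W)

    Near : A → A → Set
    Near u v = u ≡ v ⊎ R u v

    far? : ∀ u v → Dec (¬ Near u v)
    far? u v = ¬? ((u ≟ v) ⊎-dec R? u v)

  -- `pairs` lists ordered pairs, so every `W` within `U` has average degree at most `k`. The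
  -- condition is hereditary and survives the deletion of vertices.
  Sparse : List A → Set
  Sparse U = ∀ {W} → Unique W → W ⊆ U → length (pairs W) ≤ k * length W

  -- Averaging: if every degree exceeded `k`, there would be more than `k * length U` related pairs.
  lowDegree : ∀ {U x} → x ∈ U → Unique U → Sparse U → ∃[ u ] (u ∈ U × length (filter (R? u) U) ≤ k)
  lowDegree {U} x∈U U! sparse with Any.any? (λ u → length (filter (R? u) U) ≤? k) U
  ... | yes any = find any
  ... | no none = contradiction (∈-length x∈U) (≤⇒≯ |U|≤0)
    where
    open ≤-Reasoning
    |U|≤0 : length U ≤ 0
    |U|≤0 = +-cancelʳ-≤ (k * length U) _ _ (begin
      length U + k * length U ≡⟨ *-comm (suc k) (length U) ⟩
      length U * suc k        ≤⟨ length-filter-product (uncurry R?) U U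
                                   (λ u∈U → ≰⇒> (All.lookup (¬Any⇒All¬ U none) u∈U)) ⟩
      length (pairs U)        ≤⟨ sparse U! id ⟩
      k * length U            ∎)

  Independent : List A → Set
  Independent W = ∀ {u v} → u ∈ W → v ∈ W → u ≢ v → ¬ R u v

  LargeIndependent : List A → Set
  LargeIndependent U =
    ∃[ W ] (Unique W × W ⊆ U × Independent W × length U ≤ suc k * length W)

  -- Greedy choice: a vertex of degree at most `k` is taken and deleted together with its
  -- neighbours, so each chosen vertex pays for at most `k + 1` deleted ones.
  independent : ∀ {U} → Unique U → Sparse U → LargeIndependent U
  independent {U₀} = go (length U₀) ≤-refl
    where
    -- `f` bounds the length of `U`, which drops because `u` counts as near itself.
    go : ∀ f {U} → length U ≤ f → Unique U → Sparse U → LargeIndependent U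
    go _ {[]} _ _ _ = [] , [] , id , (λ ()) , z≤n
    go zero {_ ∷ _} ()
    go (suc f) {U@(_ ∷ _)} U≤f U! sparse
      with u , u∈U , deg≤k ← lowDegree (here refl) U! sparse
      with W , W! , W⊆ , ind , U′≤ ← go f {filter (far? u) U}
             (≤-pred (≤-trans (filter-notAll (far? u) U (lose u∈U λ ¬near → ¬near (inj₁ refl))) U≤f))
             (Unique.filter⁺ (far? u) U!)
             (λ V! V⊆ → sparse V! (proj₁ ∘ ∈-filter⁻ (far? u) ∘ V⊆))
      = u ∷ W , ¬Any⇒All¬ W (λ u∈W → far u∈W (inj₁ refl)) ∷ W! ,
        (λ { (here refl) → u∈U ; (there v∈W) → proj₁ (∈-filter⁻ (far? u) (W⊆ v∈W)) }) ,
        ind′ , bound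
      where
      far : ∀ {v} → v ∈ W → ¬ Near u v
      far v∈W = proj₂ (∈-filter⁻ (far? u) {xs = U} (W⊆ v∈W))

      ind′ : Independent (u ∷ W)
      ind′ (here refl) (here refl) u≢u _ = u≢u refl
      ind′ (here refl) (there v∈)  _ Ruv = far v∈ (inj₂ Ruv)
      ind′ (there v∈)  (here refl) _ Rvu = far v∈ (inj₂ (R-sym Rvu))
      ind′ (there v∈)  (there w∈)        = ind v∈ w∈

      cover : U ⊆ (u ∷ filter (R? u) U) ++ filter (far? u) U
      cover {v} v∈U with u ≟ v | R? u v
      ... | yes refl | _       = here refl
      ... | no _     | yes Ruv = there (∈-++⁺ˡ (∈-filter⁺ (R? u) v∈U Ruv))
      ... | no u≢v   | no ¬Ruv = there (∈-++⁺ʳ (filter (R? u) U) (∈-filter⁺ (far? u) v∈U [ u≢v , ¬Ruv ]))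

      open ≤-Reasoning
      bound : length U ≤ suc k * suc (length W)
      bound = begin
        length U
          ≤⟨ unique-⊆⇒length≤ U! cover ⟩
        length ((u ∷ filter (R? u) U) ++ filter (far? u) U)
          ≡⟨ length-++ (u ∷ filter (R? u) U) ⟩
        suc (length (filter (R? u) U)) + length (filter (far? u) U)
          ≤⟨ +-mono-≤ (s≤s deg≤k) U′≤ ⟩
        suc k + suc k * length W
          ≡⟨ *-suc (suc k) (length W) ⟨
        suc k * suc (length W) ∎

-- Subsets and lists

subset : {P : Pred (Fin n) 0ℓ} → Decidable P → Subset n
subset P? = tabulate (does ∘ P?)

∈-subset⁺ : {P : Pred (Fin n) 0ℓ} (P? : Decidable P) → ∀ {x} → P x → x ∈ˢ subset P?
∈-subset⁺ P? {x} Px = lookup⇒[]= x _ (trans (lookup∘tabulate _ x) (dec-true (P? x) Px))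

∈-subset⁻ : {P : Pred (Fin n) 0ℓ} (P? : Decidable P) → ∀ {x} → x ∈ˢ subset P? → P x
∈-subset⁻ P? {x} x∈ with P? x | trans (sym (lookup∘tabulate (does ∘ P?) x)) ([]=⇒lookup x∈)
... | yes Px | _ = Px

elements : Subset n → List (Fin n)
elements []            = []
elements (inside ∷ p)  = zero ∷ map suc (elements p)
elements (outside ∷ p) = map suc (elements p)

length-elements : (p : Subset n) → length (elements p) ≡ ∣ p ∣
length-elements []            = refl
length-elements (inside ∷ p)  = cong suc (trans (length-map suc (elements p)) (length-elements p))
length-elements (outside ∷ p) = trans (length-map suc (elements p)) (length-elements p)

∈-elements⁺ : {p : Subset n} {x : Fin n} → x ∈ˢ p → x ∈ elements p
∈-elements⁺ here                             = here refl
∈-elements⁺ {p = inside ∷ _}  (there x∈p) = there (∈-map⁺ suc (∈-elements⁺ x∈p))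
∈-elements⁺ {p = outside ∷ _} (there x∈p) = ∈-map⁺ suc (∈-elements⁺ x∈p)

∈-elements⁻ : (p : Subset n) {x : Fin n} → x ∈ elements p → x ∈ˢ p
∈-elements⁻ (inside ∷ p)  (here refl) = here
∈-elements⁻ (inside ∷ p)  (there x∈) with _ , y∈ , refl ← ∈-map⁻ suc x∈ = there (∈-elements⁻ p y∈)
∈-elements⁻ (outside ∷ p) x∈         with _ , y∈ , refl ← ∈-map⁻ suc x∈ = there (∈-elements⁻ p y∈)

elements-unique : (p : Subset n) → Unique (elements p)
elements-unique []            = []
elements-unique (inside ∷ p)  =
  ¬Any⇒All¬ _ (λ 0∈ → case-0 (∈-map⁻ suc 0∈)) ∷ Unique.map⁺ Fin.suc-injective (elements-unique p)
  where
  case-0 : ¬ (∃[ y ] (y ∈ elements p × zero ≡ suc y))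
  case-0 (_ , _ , ())
elements-unique (outside ∷ p) = Unique.map⁺ Fin.suc-injective (elements-unique p)

_∈?_ : (x : Fin n) (xs : List (Fin n)) → Dec (x ∈ xs)
_∈?_ = DecMembership._∈?_ Fin._≟_

fromList : List (Fin n) → Subset n
fromList xs = subset (_∈? xs)

∣fromList∣≤length : (xs : List (Fin n)) → ∣ fromList xs ∣ ≤ length xs
∣fromList∣≤length xs = subst (_≤ length xs) (length-elements (fromList xs))
  (unique-⊆⇒length≤ (elements-unique (fromList xs))
    (∈-subset⁻ (_∈? xs) ∘ ∈-elements⁻ (fromList xs)))

-- Walks of bounded length inside a set of vertices

module _ {G : Graph} where
  open Graph G using (Adj; adj?; symmetric)

  -- Walks with at most `k` edges, not paths: concatenation is then free, and `reach⇒simple` removes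
  -- repetitions where a path is wanted.
  data Reach (P : Pred (Vertex G) 0ℓ) : ℕ → Vertex G → Vertex G → Set where
    here : ∀ {k v} → P v → Reach P k v v
    step : ∀ {k u v w} → P u → Adj u v → Reach P k v w → Reach P (suc k) u w

  private variable
    P Q : Pred (Vertex G) 0ℓ
    j k l : ℕ
    u v w x : Vertex G

  reach-map : (∀ {x} → P x → Q x) → Reach P k u v → Reach Q k u v
  reach-map f (here Pv)     = here (f Pv)
  reach-map f (step Pu a p) = step (f Pu) a (reach-map f p)

  reach-weaken : k ≤ l → Reach P k u v → Reach P l u v
  reach-weaken _         (here Pv)     = here Pv
  reach-weaken (s≤s k≤l) (step Pu a p) = step Pu a (reach-weaken k≤l p)

  reach-source : Reach P k u v → P u
  reach-source (here Pv)     = Pv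
  reach-source (step Pu _ _) = Pu

  reach-target : Reach P k u v → P v
  reach-target (here Pv)    = Pv
  reach-target (step _ _ p) = reach-target p

  reach-trans : Reach P k u v → Reach P l v w → Reach P (k + l) u w
  reach-trans {k = k} {l = l} (here _) q = reach-weaken (m≤n+m l k) q
  reach-trans (step Pu a p) q            = step Pu a (reach-trans p q)

  reach-snoc : Reach P k u v → Adj v w → P w → Reach P (suc k) u w
  reach-snoc (here Pv) a Pw      = step Pv a (here Pw)
  reach-snoc (step Pu b p) a Pw = step Pu b (reach-snoc p a Pw)

  reach-sym : Reach P k u v → Reach P k v u
  reach-sym (here Pv)     = here Pv
  reach-sym (step Pu a p) = reach-snoc (reach-sym p) (symmetric a) Pu

  -- Lets a ball serve as a branch set: a walk from the centre to a vertex of the ball stays in the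
  -- ball.
  reach-prefixes : Reach P k u v → Reach (Reach P k u) k u v
  reach-prefixes (here Pv)     = here (here Pv)
  reach-prefixes (step Pu a p) = step (here Pu) a (reach-map (step Pu a) (reach-prefixes p))

  reach? : Decidable P → ∀ k u v → Dec (Reach P k u v)
  reach? P? zero u v =
    map′ (λ { (Pu , refl) → here Pu }) (λ { (here Pu) → Pu , refl }) (P? u ×-dec u Fin.≟ v)
  reach? P? (suc k) u v =
    map′ (λ { (Pu , inj₁ refl) → here Pu ; (Pu , inj₂ (_ , a , p)) → step Pu a p })
         (λ { (here Pu) → Pu , inj₁ refl ; (step Pu a p) → Pu , inj₂ (_ , a , p) })
         (P? u ×-dec (u Fin.≟ v ⊎-dec any? λ x → adj? u x ×-dec reach? P? k x v))

  -- `s` is the first vertex of the walk in `Q`. As `u` is outside `Q`, at least one edge leads to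
  -- `s`, whence `pred k`.
  reach-avoid : Decidable Q → Reach P k u v → ¬ Q u →
                Reach (λ x → ¬ Q x) k u v ⊎ ∃[ s ] (Q s × Reach P (pred k) s v)
  reach-avoid Q? (here _) ¬Qu = inj₁ (here ¬Qu)
  reach-avoid {k = suc k} Q? (step {v = x} _ a p) ¬Qu with Q? x
  ... | yes Qx = inj₂ (x , Qx , p)
  ... | no ¬Qx with reach-avoid Q? p ¬Qx
  ...   | inj₁ q            = inj₁ (step ¬Qu a q)
  ...   | inj₂ (s , Qs , q) = inj₂ (s , Qs , reach-weaken pred[n]≤n q)

  reach-exit : Decidable Q → Reach P k u v → ¬ Q u → Q v →
               ∃[ a ] ∃[ b ] (Reach (λ x → ¬ Q x) k u a × Adj a b × Q b × P b)
  reach-exit Q? (here _) ¬Qu Qv = contradiction Qv ¬Qu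
  reach-exit Q? (step {u = u} {v = x} _ a p) ¬Qu Qv with Q? x
  ... | yes Qx = u , x , here ¬Qu , a , Qx , reach-source p
  ... | no ¬Qx =
    let y , z , q , b , Qz , Pz = reach-exit Q? p ¬Qx Qv in y , z , step ¬Qu a q , b , Qz , Pz

  fromWalk : (p : Walk G u v k) → All P (vertices p) → Reach P k u v
  fromWalk stop       (Pu ∷ []) = here Pu
  fromWalk (step a p) (Pu ∷ Ps) = step Pu a (fromWalk p Ps)

  walk-prefix : (p : Walk G u v k) → x ∈ vertices p → Reach (_∈ vertices p) k u x
  walk-prefix stop       (here refl) = here (here refl)
  walk-prefix (step a p) (here refl) = here (here refl)
  walk-prefix (step a p) (there x∈p) = step (here refl) a (reach-map there (walk-prefix p x∈p))

  walk-suffix : (p : Walk G u v k) → x ∈ vertices p → Reach (_∈ vertices p) k x v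
  walk-suffix stop       (here refl) = here (here refl)
  walk-suffix (step a p) (here refl) = fromWalk (step a p) (All.tabulate id)
  walk-suffix (step a p) (there x∈p) = reach-weaken (n≤1+n _) (reach-map there (walk-suffix p x∈p))

  walk-target : (p : Walk G u v k) → v ∈ vertices p
  walk-target stop       = here refl
  walk-target (step _ p) = there (walk-target p)

  walk-source : (p : Walk G u v k) → u ∈ vertices p
  walk-source stop       = here refl
  walk-source (step _ p) = here refl

  length-vertices : (p : Walk G u v k) → length (vertices p) ≡ suc k
  length-vertices stop       = refl
  length-vertices (step _ p) = cong suc (length-vertices p)

  -- `InBall` with a predicate in place of the subset; for membership in a subset the two agree by
  -- definition.
  SimpleWalk : Pred (Vertex G) 0ℓ → ℕ → Vertex G → Vertex G → Set
  SimpleWalk P k u v =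
    ∃[ j ] (j ≤ k × (Σ[ p ∈ Walk G u v j ] (Unique (vertices p) × All P (vertices p))))

  simple-suffix : (p : Walk G u v k) → Unique (vertices p) → All P (vertices p) →
                  x ∈ vertices p → SimpleWalk P k x v
  simple-suffix stop       p!       Ps       (here refl) = _ , ≤-refl , stop , p! , Ps
  simple-suffix (step a p) p!       Ps       (here refl) = _ , ≤-refl , step a p , p! , Ps
  simple-suffix (step a p) (_ ∷ p!) (_ ∷ Ps) (there x∈p) =
    let j , j≤k , q = simple-suffix p p! Ps x∈p in j , m≤n⇒m≤1+n j≤k , q

  reach⇒simple : Reach P k u v → SimpleWalk P k u v
  reach⇒simple (here Pv) = 0 , z≤n , stop , [] ∷ [] , Pv ∷ []
  reach⇒simple (step {u = u} Pu a q) with reach⇒simple q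
  ... | j , j≤k , p , p! , Ps with u ∈? vertices p
  ...   | no u∉p  = suc j , s≤s j≤k , step a p , ¬Any⇒All¬ _ u∉p ∷ p! , Pu ∷ Ps
  ...   | yes u∈p =
    let i , i≤j , q = simple-suffix p p! Ps u∈p in i , m≤n⇒m≤1+n (≤-trans i≤j j≤k) , q

  reach⇒inBall : ∀ {A} → Reach (_∈ˢ A) k u v → InBall G A k u v
  reach⇒inBall = reach⇒simple

  inBall⇒reach : ∀ {A} → InBall G A k u v → Reach (_∈ˢ A) k u v
  inBall⇒reach (_ , j≤k , p , _ , p⊆A) = reach-weaken j≤k (fromWalk p p⊆A)

  record Split {k u v} (p : Walk G u v k) (i j : ℕ) : Set where
    constructor mkSplit
    field
      {a b} : Vertex G
      {i′ j′} : ℕ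
      i′≤i  : i′ ≤ i
      j′≤j  : j′ ≤ j
      front : Walk G u a i′
      edge  : Adj a b
      back  : Walk G b v j′
      parts : vertices p ≡ vertices front ++ vertices back

  -- The cut edge belongs to neither half, so `i + j + 1` edges can be handled: a path with `2r + 1`
  -- edges has two halves with at most `r` edges each.
  split : ∀ i {j} (p : Walk G u v (suc k)) → k ≤ i + j → Split p i j
  split zero    (step a p)    k≤j = mkSplit z≤n k≤j stop a p refl
  split (suc i) (step a stop) _   = mkSplit z≤n z≤n stop a stop refl
  split (suc i) (step {u = u} a p@(step _ _)) (s≤s k≤i+j) =
    let mkSplit i′≤i j′≤j front edge back parts = split i p k≤i+j in
    mkSplit (s≤s i′≤i) j′≤j (step a front) edge back (cong (u ∷_) parts)

-- Contractions

Touch : (G : Graph) → (Vertex G → Vertex G) → Vertex G → Vertex G → Set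
Touch G o x y = ∃[ a ] ∃[ b ] (o a ≡ x × o b ≡ y × Graph.Adj G a b)

-- A map o encodes the partition of the vertices into its fibres; the fibre of
-- a fixed point x of o is the branch set centred at x.
module _ {G : Graph} {r : ℕ} (d : ℕ) (sparse : ∀ H → ShallowMinor r H G → size H ≤ d * order H)
  (o : Vertex G → Vertex G) (radius : ∀ v → Reach {G} (λ z → o z ≡ o v) r (o v) v)
  {W : List (Vertex G)} (W! : Unique W) (fixed : ∀ {x} → x ∈ W → o x ≡ x)
  where
  open Graph G using (Adj; adj?; symmetric)

  private
    at : Fin (length W) → Vertex G
    at = lookup W

    quotient : Graph
    quotient = record
      { order     = length W
      -- Equal ends are excluded because an edge inside a fibre makes the fibre touch itself.
      ; Adj       = λ i j → at i ≢ at j × Touch G o (at i) (at j)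
      ; adj?      = λ i j → ¬? (at i Fin.≟ at j) ×-dec any? λ a → any? λ b →
                      (o a Fin.≟ at i) ×-dec (o b Fin.≟ at j) ×-dec adj? a b
      ; symmetric = λ { (x≢y , a , b , oa , ob , ab) → x≢y ∘ sym , b , a , ob , oa , symmetric ab }
      ; loopless  = λ { (x≢x , _) → x≢x refl }
      }

    fibre? : ∀ i → Decidable (λ v → o v ≡ at i)
    fibre? i v = o v Fin.≟ at i

    minor : ShallowMinor r quotient G
    minor = record
      { branch   = λ i → subset (fibre? i)
      ; disjoint = λ {i} {j} v∈i v∈j → lookup-injective W! i j
                     (trans (sym (∈-subset⁻ (fibre? i) v∈i)) (∈-subset⁻ (fibre? j) v∈j))
      ; centre   = at
      ; centre∈  = λ i → ∈-subset⁺ (fibre? i) (fixed (∈-lookup i))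
      ; radius   = λ i {v} v∈i → reach⇒inBall (ball i (∈-subset⁻ (fibre? i) v∈i))
      ; edge     = λ { {i} {j} (_ , a , b , oa , ob , ab) →
                       a , b , ∈-subset⁺ (fibre? i) oa , ∈-subset⁺ (fibre? j) ob , ab }
      }
      where
      ball : ∀ i {v} → o v ≡ at i → Reach (_∈ˢ subset (fibre? i)) r (at i) v
      ball i {v} ov = subst (λ x → Reach (_∈ˢ subset (fibre? i)) r x v) ov
        (reach-map (λ oz → ∈-subset⁺ (fibre? i) (trans oz ov)) (radius v))

    ends : List (Vertex G × Vertex G)
    ends = map (λ (i , j) → at i , at j) (edges quotient)

    ∈-ends : ∀ {x y} → x ∈ W → y ∈ W → x ≢ y → Touch G o x y → (x , y) ∈ ends ++ map swap ends
    ∈-ends x∈ y∈ x≢y t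
      with i ← Any.index x∈ | refl ← lookup-index x∈ | j ← Any.index y∈ | refl ← lookup-index y∈
      with Fin.<-cmp i j
    ... | tri≈ _ refl _ = contradiction refl x≢y
    ... | tri< i<j _ _ = ∈-++⁺ˡ (∈-map⁺ _ (∈-filter⁺ _
          (∈-cartesianProduct⁺ (∈-allFin i) (∈-allFin j)) (i<j , x≢y , t)))
    ... | tri> _ _ j<i = ∈-++⁺ʳ ends (∈-map⁺ swap (∈-map⁺ _ (∈-filter⁺ _
          (∈-cartesianProduct⁺ (∈-allFin j) (∈-allFin i))
          (j<i , Graph.symmetric quotient {i} {j} (x≢y , t)))))

  -- Touching pairs are adjacent in the depth-`r` minor whose branch sets are the fibres over `W`.
  -- Pairs in `E` are ordered while `edges` lists each edge once, hence `d + d`.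
  touching-bound : ∀ {E} → Unique E →
    (∀ {x y} → (x , y) ∈ E → x ∈ W × y ∈ W × x ≢ y × Touch G o x y) →
    length E ≤ (d + d) * length W
  touching-bound {E} E! touch = begin
    length E
      ≤⟨ unique-⊆⇒length≤ E! (λ e∈E → let x∈ , y∈ , x≢y , t = touch e∈E in ∈-ends x∈ y∈ x≢y t) ⟩
    length (ends ++ map swap ends)
      ≡⟨ length-++ ends ⟩
    length ends + length (map swap ends)
      ≡⟨ cong (length ends +_) (length-map swap ends) ⟩
    length ends + length ends
      ≡⟨ cong (λ s → s + s) (length-map _ (edges quotient)) ⟩
    size quotient + size quotient
      ≤⟨ +-mono-≤ (sparse quotient minor) (sparse quotient minor) ⟩
    d * length W + d * length W
      ≡⟨ *-distribʳ-+ (length W) d d ⟨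
    (d + d) * length W ∎
    where open ≤-Reasoning

-- Sparse shallow minors make every vertex ranked

-- With `e = d + d`, and `c = 2r + 2` the number of vertices on a path with `2r + 1` edges, the
-- factors are: `e` for edges per vertex of the last minor, `e * c + 1` for the size of `M` and `U`
-- together relative to `U`, and `e + 1` for `U` relative to `R`.
cutBound : ℕ → ℕ → ℕ
cutBound d r = (d + d) * ((d + d) * suc (r + suc r) + 1) * suc (d + d)

module _ {G : Graph} {r : ℕ} (d : ℕ) (sparse : ∀ H → ShallowMinor r H G → size H ≤ d * order H)
  {U : List (Vertex G)} (U! : Unique U)
  where
  open Graph G using (Adj; adj?)

  private
    V : Set
    V = Vertex G

    e c : ℕ
    e = d + d
    c = suc (r + suc r)

    _∈ₚ?_ : (q : V × V) (P : List (V × V)) → Dec (q ∈ P)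
    _∈ₚ?_ = DecMembership._∈?_ (≡-dec Fin._≟_ Fin._≟_)

  -- Families of disjoint linking paths

  Free : List V → V → Set
  Free M z = z ∉ M × z ∉ U

  free? : ∀ M → Decidable (Free M)
  free? M z = ¬? (z ∈? M) ×-dec ¬? (z ∈? U)

  -- `r + suc r` is the greatest number of edges for which a path, cut at one edge, can fall into
  -- two halves with at most `r` edges each.
  Link : List V → V → V → Set
  Link M u v = Reach {G} (λ z → z ≡ u ⊎ z ≡ v ⊎ Free M z) (r + suc r) u v

  link? : ∀ M u v → Dec (Link M u v)
  link? M u v = reach? (λ z → (z Fin.≟ u) ⊎-dec (z Fin.≟ v) ⊎-dec free? M z) (r + suc r) u v

  Related : List (V × V) → V → V → Set
  Related P u v = (u , v) ∈ P ⊎ (v , u) ∈ P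

  related? : ∀ P → Decidable₂ (Related P)
  related? P u v = ((u , v) ∈ₚ? P) ⊎-dec ((v , u) ∈ₚ? P)

  related-sym : ∀ P → Symmetric₂ (Related P)
  related-sym P (inj₁ uv) = inj₂ uv
  related-sym P (inj₂ vu) = inj₁ vu

  -- The pairs in P are joined by internally disjoint paths, whose vertices are
  -- listed in M; each path is cut in the middle and o sends either half to its end.
  record Linkage (P : List (V × V)) : Set where
    field
      M      : List V
      o      : V → V
      radius : ∀ v → Reach {G} (λ z → o z ≡ o v) r (o v) v
      origin : ∀ v → o v ≡ v ⊎ (v ∈ M × o v ∈ U)
      fixed  : ∀ {u} → u ∈ U → o u ≡ u
      P!     : Unique P
      joined : ∀ {u v} → (u , v) ∈ P → u ∈ U × v ∈ U × u ≢ v × Touch G o u v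
      M≤     : length M ≤ length P * c

    joined′ : ∀ {u v} → Related P u v → u ≢ v × Touch G o u v
    joined′ (inj₁ uv) = let _ , _ , u≢v , t = joined uv in u≢v , t
    joined′ (inj₂ vu) = let _ , _ , v≢u , a , b , oa , ob , ab = joined vu in
      v≢u ∘ sym , b , a , ob , oa , Graph.symmetric G ab

  empty : Linkage []
  empty = record
    { M = [] ; o = id ; radius = λ v → here refl ; origin = λ _ → inj₁ refl ; fixed = λ _ → refl
    ; P! = [] ; joined = λ () ; M≤ = z≤n }

  module _ {P} (L : Linkage P) {u v} (u∈U : u ∈ U) (v∈U : v ∈ U) (u≢v : u ≢ v) (uv∉P : (u , v) ∉ P)
    where
    open Linkage L

    private
      module _ {j} (j≤ : j ≤ r + r) (p : Walk G u v (suc j)) (p! : Unique (vertices p))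
        (p⊆ : All (λ z → z ≡ u ⊎ z ≡ v ⊎ Free M z) (vertices p))
        where
        open Split (split r p j≤)

        Fs Bs : List V
        Fs = vertices front
        Bs = vertices back

        F∩B : ∀ {z} → z ∈ Fs → z ∉ Bs
        F∩B = ++⁻-disjoint Fs (subst Unique parts p!)

        F⊆p : ∀ {z} → z ∈ Fs → z ∈ vertices p
        F⊆p z∈F = subst (_ ∈_) (sym parts) (∈-++⁺ˡ z∈F)

        B⊆p : ∀ {z} → z ∈ Bs → z ∈ vertices p
        B⊆p z∈B = subst (_ ∈_) (sym parts) (∈-++⁺ʳ Fs z∈B)

        o′ : V → V
        o′ z with z ∈? Fs | z ∈? Bs
        ... | yes _ | _     = u
        ... | no _  | yes _ = v
        ... | no _  | no _  = o z

        o′-F : ∀ {z} → z ∈ Fs → o′ z ≡ u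
        o′-F {z} z∈F with z ∈? Fs
        ... | yes _  = refl
        ... | no z∉F = contradiction z∈F z∉F

        o′-B : ∀ {z} → z ∈ Bs → o′ z ≡ v
        o′-B {z} z∈B with z ∈? Fs | z ∈? Bs
        ... | yes z∈F | _      = contradiction z∈B (F∩B z∈F)
        ... | no _    | yes _  = refl
        ... | no _    | no z∉B = contradiction z∈B z∉B

        o′-cases : ∀ z → z ∈ Fs ⊎ z ∈ Bs ⊎ o′ z ≡ o z
        o′-cases z with z ∈? Fs | z ∈? Bs
        ... | yes z∈F | _       = inj₁ z∈F
        ... | no _    | yes z∈B = inj₂ (inj₁ z∈B)
        ... | no _    | no _    = inj₂ (inj₂ refl)

        free-owner : ∀ {z} → Free M z → o z ∉ U
        free-owner {z} (z∉M , z∉U) oz∈U with origin z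
        ... | inj₁ eq        = z∉U (subst (_∈ U) eq oz∈U)
        ... | inj₂ (z∈M , _) = z∉M z∈M

        -- Apart from `u` and `v` the new path consists of free vertices, which lie in no old fibre
        -- over `U`. Hence those fibres can only grow.
        o′-old : ∀ {z} → o z ∈ U → o′ z ≡ o z
        o′-old {z} oz∈U with o′-cases z
        ... | inj₂ (inj₂ eq) = eq
        ... | inj₁ z∈F with All.lookup p⊆ (F⊆p z∈F)
        ...   | inj₁ refl        = trans (o′-F z∈F) (sym (fixed u∈U))
        ...   | inj₂ (inj₁ refl) = contradiction (walk-target back) (F∩B z∈F)
        ...   | inj₂ (inj₂ free) = contradiction oz∈U (free-owner free)
        o′-old {z} oz∈U | inj₂ (inj₁ z∈B) with All.lookup p⊆ (B⊆p z∈B)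
        ...   | inj₁ refl        = contradiction z∈B (F∩B (walk-source front))
        ...   | inj₂ (inj₁ refl) = trans (o′-B z∈B) (sym (fixed v∈U))
        ...   | inj₂ (inj₂ free) = contradiction oz∈U (free-owner free)

        radius′ : ∀ z → Reach {G} (λ y → o′ y ≡ o′ z) r (o′ z) z
        radius′ z with o′-cases z
        ... | inj₁ z∈F = subst (λ x → Reach {G} (λ y → o′ y ≡ x) r x z) (sym (o′-F z∈F))
          (reach-weaken i′≤i (reach-map o′-F (walk-prefix front z∈F)))
        ... | inj₂ (inj₁ z∈B) = subst (λ x → Reach {G} (λ y → o′ y ≡ x) r x z) (sym (o′-B z∈B))
          (reach-weaken j′≤j (reach-map o′-B (reach-sym (walk-suffix back z∈B))))
        ... | inj₂ (inj₂ eq) with origin z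
        ...   | inj₁ oz = subst (λ x → Reach {G} (λ y → o′ y ≡ x) r x z) (sym (trans eq oz))
          (here (trans eq oz))
        -- The fibre over `o z` has lost no vertex, so the old walk still lies in it.
        ...   | inj₂ (_ , oz∈U) = subst (λ x → Reach {G} (λ y → o′ y ≡ x) r x z) (sym eq)
          (reach-map (λ oy → trans (o′-old (subst (_∈ U) (sym oy) oz∈U)) oy) (radius z))

        origin′ : ∀ z → o′ z ≡ z ⊎ (z ∈ vertices p ++ M × o′ z ∈ U)
        origin′ z with o′-cases z
        ... | inj₁ z∈F        = inj₂ (∈-++⁺ˡ (F⊆p z∈F) , subst (_∈ U) (sym (o′-F z∈F)) u∈U)
        ... | inj₂ (inj₁ z∈B) = inj₂ (∈-++⁺ˡ (B⊆p z∈B) , subst (_∈ U) (sym (o′-B z∈B)) v∈U)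
        ... | inj₂ (inj₂ eq) with origin z
        ...   | inj₁ oz           = inj₁ (trans eq oz)
        ...   | inj₂ (z∈M , oz∈U) = inj₂ (∈-++⁺ʳ (vertices p) z∈M , subst (_∈ U) (sym eq) oz∈U)

        joined″ : ∀ {x y} → (x , y) ∈ (u , v) ∷ P → x ∈ U × y ∈ U × x ≢ y × Touch G o′ x y
        joined″ (here refl) =
          u∈U , v∈U , u≢v , a , b , o′-F (walk-target front) , o′-B (walk-source back) , edge
        joined″ (there xy∈P) =
          let x∈U , y∈U , x≢y , s , t , os , ot , st = joined xy∈P in
          x∈U , y∈U , x≢y , s , t ,
          trans (o′-old (subst (_∈ U) (sym os) x∈U)) os ,
          trans (o′-old (subst (_∈ U) (sym ot) y∈U)) ot , st

        M′≤ : length (vertices p ++ M) ≤ c + length P * c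
        M′≤ = begin
          length (vertices p ++ M)         ≡⟨ length-++ (vertices p) ⟩
          length (vertices p) + length M   ≡⟨ cong (_+ length M) (length-vertices p) ⟩
          suc (suc j) + length M           ≤⟨ +-mono-≤ (s≤s (s≤s j≤)) M≤ ⟩
          suc (suc (r + r)) + length P * c ≡⟨ cong (λ s → suc s + length P * c) (+-suc r r) ⟨
          c + length P * c                 ∎
          where open ≤-Reasoning

        extendAlong : Linkage ((u , v) ∷ P)
        extendAlong = record
          { M      = vertices p ++ M
          ; o      = o′
          ; radius = radius′
          ; origin = origin′
          ; fixed  = λ x∈U → trans (o′-old (subst (_∈ U) (sym (fixed x∈U)) x∈U)) (fixed x∈U)
          ; P!     = ¬Any⇒All¬ P uv∉P ∷ P!
          ; joined = joined″
          ; M≤     = M′≤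
          }

    extend : Link M u v → Linkage ((u , v) ∷ P)
    extend link with reach⇒simple link
    ... | zero  , _    , stop , _  , _  = contradiction refl u≢v
    ... | suc j , 1+j≤ , p    , p! , p⊆ =
      extendAlong (≤-pred (subst (suc j ≤_) (+-suc r r) 1+j≤)) p p! p⊆

  -- Contracting the halves of the paths makes the pairs in `P` adjacent in a depth-`r` minor on
  -- `U`.
  ∣P∣≤ : ∀ {P} → Linkage P → length P ≤ e * length U
  ∣P∣≤ L = touching-bound d sparse o radius U! fixed P! joined where open Linkage L

  Maximal : ∀ {P} → Linkage P → Set
  Maximal {P} L = ∀ {u v} → u ∈ U → v ∈ U → u ≢ v → ¬ Related P u v → ¬ Link (Linkage.M L) u v

  -- Paths are added as long as possible. The fuel cannot run out, since `∣P∣≤` caps the number of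
  -- pairs in any linkage.
  maximal : ∃[ P ] (Σ[ L ∈ Linkage P ] Maximal L)
  maximal = go (suc (e * length U)) empty (m≤m+n _ 0)
    where
    go : ∀ f {P} → Linkage P → e * length U < f + length P → ∃[ P ] (Σ[ L ∈ Linkage P ] Maximal L)
    go zero    L enough = contradiction (∣P∣≤ L) (<⇒≱ enough)
    go (suc f) {P} L enough
      with any? (λ u → any? λ v → (u ∈? U) ×-dec (v ∈? U) ×-dec ¬? (u Fin.≟ v)
             ×-dec ¬? (related? P u v) ×-dec link? (Linkage.M L) u v)
    ... | yes (u , v , u∈U , v∈U , u≢v , ¬rel , link) =
      go f (extend L u∈U v∈U u≢v (¬rel ∘ inj₁) link)
        (subst (e * length U <_) (sym (+-suc f (length P))) enough)
    ... | no none = P , L , λ {u} {v} u∈U v∈U u≢v ¬rel link →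
      none (u , v , u∈U , v∈U , u≢v , ¬rel , link)

  -- Exits of disjoint balls and the final count

  private
    module Final {P} (L : Linkage P) (max : Maximal L)
      {R : List V} (R! : Unique R) (R⊆U : R ⊆ U)
      (R-ind : Independent Fin._≟_ (related? P) (related-sym P) e R)
      (U≤ : length U ≤ suc e * length R)
      (blocked : ∀ {u} → u ∈ U → ∀ S → u ∉ˢ S → ∣ S ∣ ≤ cutBound d r →
                 ∃[ w ] (w ∈ U × w ≢ u × InBall G (∁ S) r u w))
      where
      open Linkage L using (M; M≤)

      Local : V → V → Set
      Local u z = z ≡ u ⊎ Free M z

      local? : ∀ u → Decidable (Local u)
      local? u z = (z Fin.≟ u) ⊎-dec free? M z

      Region : V → V → Set
      Region u = Reach {G} (Local u) r u

      region? : ∀ u → Decidable (Region u)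
      region? u = reach? (local? u) r u

      -- Two regions that meet give a walk with at most `2r` edges through free vertices, a link
      -- between unrelated vertices that maximality forbids.
      region-disjoint : ∀ {u v x} → u ∈ R → v ∈ R → Region u x → Region v x → u ≡ v
      region-disjoint {u} {v} u∈R v∈R ux vx with u Fin.≟ v
      ... | yes u≡v = u≡v
      ... | no u≢v  = contradiction link (max (R⊆U u∈R) (R⊆U v∈R) u≢v (R-ind u∈R v∈R u≢v))
        where
        link : Link M u v
        link = reach-weaken (+-monoʳ-≤ r (n≤1+n r))
          (reach-trans (reach-map (λ { (inj₁ eq) → inj₁ eq ; (inj₂ f) → inj₂ (inj₂ f) }) ux)
                       (reach-map inj₂ (reach-sym vx)))

      o : V → V
      o x with Any.any? (λ u → region? u x) R
      ... | yes any = proj₁ (find any)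
      ... | no _    = x

      o-cases : ∀ x → (o x ∈ R × Region (o x) x) ⊎ (o x ≡ x × (∀ {u} → u ∈ R → ¬ Region u x))
      o-cases x with Any.any? (λ u → region? u x) R
      ... | yes any = inj₁ (proj₂ (find any))
      ... | no none = inj₂ (refl , λ u∈R ux → none (lose u∈R ux))

      o-region : ∀ {u x} → u ∈ R → Region u x → o x ≡ u
      o-region {u} {x} u∈R ux with o-cases x
      ... | inj₁ (v∈R , vx) = region-disjoint v∈R u∈R vx ux
      ... | inj₂ (_ , none) = contradiction ux (none u∈R)

      radius : ∀ x → Reach {G} (λ z → o z ≡ o x) r (o x) x
      radius x with o-cases x
      ... | inj₁ (u∈R , ux) = reach-map (o-region u∈R) (reach-prefixes ux)
      ... | inj₂ (eq , _)   = subst (λ y → Reach {G} (λ z → o z ≡ y) r y x) (sym eq) (here eq)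

      W : List V
      W = deduplicate Fin._≟_ (M ++ U)

      W! : Unique W
      W! = DecUnique.deduplicate-! Fin._≟_ (M ++ U)

      -- A region meets `M` and `U` only in its centre.
      fixed : ∀ {x} → x ∈ W → o x ≡ x
      fixed {x} x∈W with o-cases x
      ... | inj₂ (eq , _) = eq
      ... | inj₁ (_ , ux) with reach-target ux | ∈-++⁻ M (∈-deduplicate⁻ Fin._≟_ (M ++ U) x∈W)
      ...   | inj₁ eq          | _        = sym eq
      ...   | inj₂ (x∉M , _)   | inj₁ x∈M = contradiction x∈M x∉M
      ...   | inj₂ (_   , x∉U) | inj₂ x∈U = contradiction x∈U x∉U

      Exit : V × V → Set
      Exit (u , w) = w ≢ u × ∃[ a ] (Region u a × Adj a w)

      exit? : Decidable Exit
      exit? (u , w) = ¬? (w Fin.≟ u) ×-dec any? λ a → region? u a ×-dec adj? a w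

      exits : V → List V
      exits u = filter (λ w → exit? (u , w)) W

      -- The exits of u separate it from the rest of U.
      many-exits : ∀ {u} → u ∈ U → cutBound d r < length (exits u)
      many-exits {u} u∈U with suc (cutBound d r) ≤? length (exits u)
      ... | yes many = many
      ... | no few
        with w , w∈U , w≢u , ball ← blocked u∈U (fromList (exits u))
               (λ u∈S → proj₁ (proj₂ (∈-filter⁻ _ {xs = W} (∈-subset⁻ (_∈? exits u) u∈S))) refl)
               (≤-trans (∣fromList∣≤length (exits u)) (≤-pred (≰⇒> few)))
        -- On the walk to `w`, `b` is the first vertex that is neither `u` nor free. It is an exit,
        -- although the walk avoids all exits.
        with a , b , ua , ab , ¬local , b∉S ←
               reach-exit (λ z → ¬? (local? u z)) (inBall⇒reach ball)
                 (λ ¬local → ¬local (inj₁ refl))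
                 (λ { (inj₁ eq) → w≢u eq ; (inj₂ (_ , w∉U)) → w∉U w∈U })
        = contradiction (∈-subset⁺ (_∈? exits u) b∈exits) (x∈∁p⇒x∉p b∉S)
        where
        b∈W : b ∈ W
        b∈W with b ∈? M | b ∈? U
        ... | yes b∈M | _       = ∈-deduplicate⁺ Fin._≟_ (∈-++⁺ˡ b∈M)
        ... | no _    | yes b∈U = ∈-deduplicate⁺ Fin._≟_ (∈-++⁺ʳ M b∈U)
        ... | no b∉M  | no b∉U  = contradiction (inj₂ (b∉M , b∉U)) ¬local

        b∈exits : b ∈ exits u
        b∈exits = ∈-filter⁺ _ b∈W (¬local ∘ inj₁ ,
          a , reach-map (decidable-stable (local? u _)) ua , ab)

      E : List (V × V)
      E = filter exit? (cartesianProduct R W)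

      -- After contraction of the regions, each one touches the fibres of its exits, which are fixed
      -- points of `o`.
      E≤ : length E ≤ e * length W
      E≤ = touching-bound d sparse o radius W! fixed
        (Unique.filter⁺ exit? (Unique.cartesianProduct⁺ R! W!))
        λ xy∈E → let xy∈ , w≢u , a , ua , aw = ∈-filter⁻ exit? {xs = cartesianProduct R W} xy∈E
                     u∈R , w∈W = ∈-cartesianProduct⁻ R W xy∈ in
          ∈-deduplicate⁺ Fin._≟_ (∈-++⁺ʳ M (R⊆U u∈R)) , w∈W , w≢u ∘ sym ,
          a , _ , o-region u∈R ua , fixed w∈W , aw

      collect : ∀ e c n → e * n * c + n ≡ (e * c + 1) * n
      collect = solve-∀

      reassoc : ∀ a b c n → a * (b * (c * n)) ≡ a * b * c * n
      reassoc = solve-∀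

      open ≤-Reasoning

      W≤ : length W ≤ (e * c + 1) * length U
      W≤ = begin
        length W                          ≤⟨ length-deduplicate Fin._≟_ (M ++ U) ⟩
        length (M ++ U)                   ≡⟨ length-++ M ⟩
        length M + length U               ≤⟨ +-monoˡ-≤ (length U) (≤-trans M≤ (*-monoˡ-≤ c (∣P∣≤ L))) ⟩
        e * length U * c + length U       ≡⟨ collect e c (length U) ⟩
        (e * c + 1) * length U            ∎

      -- Each vertex of `R` has more than `cutBound d r` exits, while `E≤` allows only
      -- `cutBound d r` per vertex on average.
      R≤0 : length R ≤ 0
      R≤0 = +-cancelʳ-≤ (cutBound d r * length R) _ _ (begin
        length R + cutBound d r * length R
          ≡⟨ *-comm (suc (cutBound d r)) (length R) ⟩
        length R * suc (cutBound d r)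
          ≤⟨ length-filter-product exit? R W (many-exits ∘ R⊆U) ⟩
        length E
          ≤⟨ E≤ ⟩
        e * length W
          ≤⟨ *-monoʳ-≤ e (≤-trans W≤ (*-monoʳ-≤ (e * c + 1) U≤)) ⟩
        e * ((e * c + 1) * (suc e * length R))
          ≡⟨ reassoc e (e * c + 1) (suc e) (length R) ⟩
        cutBound d r * length R ∎)

      U≤0 : length U ≤ 0
      U≤0 = begin
        length U         ≤⟨ U≤ ⟩
        suc e * length R ≤⟨ *-monoʳ-≤ (suc e) R≤0 ⟩
        suc e * 0        ≡⟨ *-zeroʳ (suc e) ⟩
        0                ∎

  -- The halves of the paths serve for every `W` within `U`: keeping only the fibres over `W` leaves
  -- a shallow minor.
  related-sparse : ∀ {P} → Linkage P → Sparse Fin._≟_ (related? P) (related-sym P) e U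
  related-sparse {P} L {W} W! W⊆U = touching-bound d sparse o radius W! (fixed ∘ W⊆U)
    (Unique.filter⁺ (uncurry (related? P)) (Unique.cartesianProduct⁺ W! W!))
    λ xy∈E → let xy∈ , rel = ∈-filter⁻ (uncurry (related? P)) {xs = cartesianProduct W W} xy∈E
                 x∈W , y∈W = ∈-cartesianProduct⁻ W W xy∈ in
      x∈W , y∈W , joined′ rel
    where open Linkage L

  unblocked : (∀ {u} → u ∈ U → ∀ S → u ∉ˢ S → ∣ S ∣ ≤ cutBound d r →
                 ∃[ w ] (w ∈ U × w ≢ u × InBall G (∁ S) r u w)) →
              ∀ {u} → u ∉ U
  unblocked blocked u∈U
    with P , L , max ← maximal
    with R , R! , R⊆U , R-ind , U≤ ←
           independent Fin._≟_ (related? P) (related-sym P) e U! (related-sparse L)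
    = contradiction (∈-length u∈U) (≤⇒≯ (Final.U≤0 L max R! R⊆U R-ind U≤ blocked))

round-fin : ∀ G r m i ρ {v j} → ρ v ≡ fin j → round G r m i ρ v ≡ fin j
round-fin G r m i ρ {v} eq with ρ v
round-fin G r m i ρ {v} refl | fin j = refl

round-∞ : ∀ G r m i ρ {v} → ρ v ≡ ∞ → round G r m i ρ v ≡ ∞ → ¬ Eligible G r m ρ v
round-∞ G r m i ρ {v} ρv eq with ρ v
round-∞ G r m i ρ {v} refl eq | ∞ with eligible? G r m ρ v
round-∞ G r m i ρ {v} refl eq | ∞ | no ¬eligible = ¬eligible

sparse⇒ranked : ∀ G r d → (∀ H → ShallowMinor r H G → size H ≤ d * order H) →
                ∀ v → rank G r (cutBound d r) v ≢ ∞
sparse⇒ranked G r d sparse v v∞ = unblocked d sparse U! blocked (∈-filter⁺ unranked? (∈-allFin v) v∞)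
  where
  m = cutBound d r
  ρ = rank G r m

  unranked? : Decidable (λ u → ρ u ≡ ∞)
  unranked? u = ρ u ≟∞

  U : List (Vertex G)
  U = filter unranked? (allFin (order G))

  U! : Unique U
  U! = Unique.filter⁺ unranked? (Unique.allFin⁺ (order G))

  blocked : ∀ {u} → u ∈ U → ∀ S → u ∉ˢ S → ∣ S ∣ ≤ m → ∃[ w ] (w ∈ U × w ≢ u × InBall G (∁ S) r u w)
  blocked {u} u∈U S u∉S ∣S∣≤m
    with any? (λ w → (w ∈? U) ×-dec ¬? (w Fin.≟ u) ×-dec inBall? G (∁ S) r u w)
  ... | yes found = found
  ... | no none   = contradiction
    (S , u∉S , ∣S∣≤m , λ w ball w≢u w∞ → none (w , ∈-filter⁺ unranked? (∈-allFin w) w∞ , w≢u , ball))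
    -- The ranking is final, so one more round leaves `u` unranked, and therefore `u` is not
    -- eligible.
    (round-∞ G r m (suc (order G)) ρ u∞ (trans (rank-final G r m (n≤1+n (order G)) u) u∞))
    where
    u∞ : ρ u ≡ ∞
    u∞ = proj₂ (∈-filter⁻ unranked? {xs = allFin (order G)} u∈U)

-- Ranked vertices make shallow minors sparse

Separates : (G : Graph) → ℕ → ℕ → (Vertex G → ℕ) → Vertex G → Subset (order G) → Set
Separates G r m ρ v S =
  v ∉ˢ S × ∣ S ∣ ≤ m × (∀ w → InBall G (∁ S) r v w → w ≢ v → ρ w < ρ v)

module _ (G : Graph) (r m : ℕ) where

  private
    height : ℕ∞ → ℕ
    height (fin i) = i
    -- An arbitrary value; heights are taken of finite ranks.
    height ∞       = 0

    fin-height : ∀ {x} → x ≢ ∞ → x ≡ fin (height x)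
    fin-height {fin _} _   = refl
    fin-height {∞}     x≢∞ = contradiction refl x≢∞

    -- The bound `i ≤ k` is carried for the induction: whatever is ranked after `k` rounds lies
    -- strictly below a vertex ranked in round `k + 1`.
    RankedAt : ℕ → Vertex G → ℕ → Set
    RankedAt k v i = i ≤ k × ∃[ S ] (v ∉ˢ S × ∣ S ∣ ≤ m ×
      (∀ w → InBall G (∁ S) r v w → w ≢ v → ∃[ j ] (j < i × ranksAfter G r m k w ≡ fin j)))

    rankedAt : ∀ k {v i} → ranksAfter G r m k v ≡ fin i → RankedAt k v i
    rankedAt (suc k) {v} {i} eq with ranksAfter G r m k v in eqₖ
    rankedAt (suc k) {v} {i} refl | fin .i =
      let i≤k , S , v∉S , ∣S∣≤m , below = rankedAt k eqₖ in
      m≤n⇒m≤1+n i≤k , S , v∉S , ∣S∣≤m , λ w ball w≢v →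
        let j , j<i , eq = below w ball w≢v in
        j , j<i , round-fin G r m (suc k) (ranksAfter G r m k) eq
    rankedAt (suc k) {v} {i} eq | ∞ with eligible? G r m (ranksAfter G r m k) v
    rankedAt (suc k) {v} {i} refl | ∞ | yes (S , v∉S , ∣S∣≤m , ranked) =
      ≤-refl , S , v∉S , ∣S∣≤m , λ w ball w≢v →
        let eq = fin-height (ranked w ball w≢v) in
        _ , s≤s (proj₁ (rankedAt k eq)) , round-fin G r m (suc k) (ranksAfter G r m k) eq

  ranked⇒separated : (∀ v → rank G r m v ≢ ∞) →
                     Σ[ ρ ∈ (Vertex G → ℕ) ] (∀ v → ∃[ S ] Separates G r m ρ v S)
  ranked⇒separated ranked = ρ , λ v →
    let _ , S , v∉S , ∣S∣≤m , below = rankedAt (order G) (fin-height (ranked v)) in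
    S , v∉S , ∣S∣≤m , λ w ball w≢v →
      let j , j<ρv , eq = below w ball w≢v in subst (_< ρ v) (sym (cong height eq)) j<ρv
    where
    ρ : Vertex G → ℕ
    ρ v = height (rank G r m v)

-- The size of the complete `m`-ary tree of depth `k`; `wreach` branches into the at most `m`
-- vertices of a separator.
reachBound : ℕ → ℕ → ℕ
reachBound m zero    = 1
reachBound m (suc k) = suc (m * reachBound m k)

module _ {G : Graph} {r m : ℕ} (ρ : Vertex G → ℕ) (sep : ∀ v → ∃[ S ] Separates G r m ρ v S) where

  -- Contains the weakly k-reachable vertices of v for the ordering by decreasing ρ.
  wreach : ℕ → Vertex G → List (Vertex G)
  wreach zero    v = v ∷ []
  wreach (suc k) v = v ∷ concatMap (wreach k) (elements (proj₁ (sep v)))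

  length-wreach : ∀ k v → length (wreach k v) ≤ reachBound m k
  length-wreach zero    v = ≤-refl
  length-wreach (suc k) v with S , _ , ∣S∣≤m , _ ← sep v = s≤s (begin
    length (concatMap (wreach k) (elements S))
      ≤⟨ length-concatMap-≤ (wreach k) (length-wreach k) (elements S) ⟩
    length (elements S) * reachBound m k
      ≡⟨ cong (_* reachBound m k) (length-elements S) ⟩
    ∣ S ∣ * reachBound m k
      ≤⟨ *-monoˡ-≤ (reachBound m k) ∣S∣≤m ⟩
    m * reachBound m k ∎)
    where open ≤-Reasoning

  -- A walk from v to a vertex u ≢ v of maximum rank on it meets the separator
  -- of v, and continues from there with fewer edges.
  ∈-wreach : ∀ k {u v} → k ≤ r → Reach {G} (λ z → ρ z ≤ ρ u) k v u → u ∈ wreach k v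
  ∈-wreach zero    k≤r (here _) = here refl
  ∈-wreach (suc k) {u} {v} k≤r p with u Fin.≟ v
  ... | yes refl = here refl
  ... | no u≢v with S , v∉S , _ , below ← sep v with reach-avoid (_∈ˢ? S) p v∉S
  -- A walk avoiding the separator would give `ρ u < ρ v`, but `v` lies on a walk where `u` has
  -- maximum rank.
  ...   | inj₁ q = contradiction (reach-source p)
    (<⇒≱ (below u (reach⇒inBall (reach-weaken k≤r (reach-map x∉p⇒x∈∁p q))) u≢v))
  ...   | inj₂ (s , s∈S , q) = there (∈-concatMap⁺ (wreach k)
    (lose (∈-elements⁺ s∈S) (∈-wreach k (≤-trans (n≤1+n k) k≤r) q)))

-- Adjacent branch sets of radius d are spanned by walks with at most 4d + 1 edges.
minorReach : ℕ → ℕ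
minorReach d = (d + d) + suc (d + d)

module _ {G H : Graph} {d m : ℕ} (minor : ShallowMinor d H G)
  (ρ : Vertex G → ℕ) (sep : ∀ v → ∃[ S ] Separates G (minorReach d) m ρ v S)
  where
  open ShallowMinor minor

  private
    -- The default value `centre x` lies in the branch set, so the maximum is attained there in any
    -- case.
    top : Vertex H → Vertex G
    top x = argmax ρ (centre x) (elements (branch x))

    top∈ : ∀ x → top x ∈ˢ branch x
    top∈ x = argmax-all ρ (centre∈ x) (All.tabulate (∈-elements⁻ (branch x)))

    ≤top : ∀ x {v} → v ∈ˢ branch x → ρ v ≤ ρ (top x)
    ≤top x v∈ = All.lookup (f[xs]≤f[argmax] (centre x) (elements (branch x))) (∈-elements⁺ v∈)

    top-injective : ∀ {x y} → top x ≡ top y → x ≡ y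
    top-injective {x} {y} eq = disjoint (top∈ x) (subst (_∈ˢ branch y) (sym eq) (top∈ y))

    inBranch : ∀ x {u v} → u ∈ˢ branch x → v ∈ˢ branch x → Reach {G} (_∈ˢ branch x) (d + d) u v
    inBranch x u∈ v∈ =
      reach-trans (reach-sym (inBall⇒reach (radius x u∈))) (inBall⇒reach (radius x v∈))

    -- The walk runs inside the branch set of `x`, crosses the edge `uv`, and runs inside that of
    -- `y`; no rank on it exceeds that of `top y`.
    top-reach : ∀ {x y} → Graph.Adj H x y → ρ (top x) ≤ ρ (top y) →
                top y ∈ wreach ρ sep (minorReach d) (top x)
    top-reach {x} {y} xy x≤y with u , v , u∈ , v∈ , uv ← edge xy =
      ∈-wreach ρ sep (minorReach d) ≤-refl
        (reach-trans (reach-map (λ z∈ → ≤-trans (≤top x z∈) x≤y) (inBranch x (top∈ x) u∈))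
          (step (≤-trans (≤top x u∈) x≤y) uv (reach-map (≤top y) (inBranch y v∈ (top∈ y)))))

    charges : Vertex H → List (Vertex H × Vertex G)
    charges x = map (x ,_) (wreach ρ sep (minorReach d) (top x))

    charged : List (Vertex H × Vertex G)
    charged = concatMap charges (allFin (order H))

    -- An edge is charged to the end with the lower top, and the other end is recorded by its top.
    charge : Vertex H × Vertex H → Vertex H × Vertex G
    charge (x , y) with ρ (top x) ≤? ρ (top y)
    ... | yes _ = x , top y
    ... | no _  = y , top x

    edge⁻ : ∀ {x y} → (x , y) ∈ edges H → x Fin.< y × Graph.Adj H x y
    edge⁻ = proj₂ ∘ ∈-filter⁻ _ {xs = cartesianProduct (allFin (order H)) (allFin (order H))}

    charge∈ : ∀ {q} → q ∈ edges H → charge q ∈ charged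
    charge∈ {x , y} q∈ with ρ (top x) ≤? ρ (top y)
    ... | yes x≤y = ∈-concatMap⁺ _ (lose (∈-allFin x) (∈-map⁺ _ (top-reach (proj₂ (edge⁻ q∈)) x≤y)))
    ... | no x≰y  = ∈-concatMap⁺ _ (lose (∈-allFin y)
      (∈-map⁺ _ (top-reach (Graph.symmetric H (proj₂ (edge⁻ q∈))) (<⇒≤ (≰⇒> x≰y)))))

    -- Branch sets are disjoint, so a charge determines both ends of its edge. In the mixed cases
    -- the two pairs would be reversals of each other, which the increasing order rules out.
    charge-injective : ∀ {x y x′ y′} → x Fin.< y → x′ Fin.< y′ →
                       charge (x , y) ≡ charge (x′ , y′) → (x , y) ≡ (x′ , y′)
    charge-injective {x} {y} {x′} {y′} x<y x′<y′ eq
      with ρ (top x) ≤? ρ (top y) | ρ (top x′) ≤? ρ (top y′) | ,-injective eq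
    ... | yes _ | yes _ | refl , t with refl ← top-injective t = refl
    ... | no _  | no _  | refl , t with refl ← top-injective t = refl
    ... | yes _ | no _  | refl , t with refl ← top-injective t = contradiction x′<y′ (<-asym x<y)
    ... | no _  | yes _ | refl , t with refl ← top-injective t = contradiction x′<y′ (<-asym x<y)

    edges! : Unique (edges H)
    edges! = Unique.filter⁺ _
      (Unique.cartesianProduct⁺ (Unique.allFin⁺ (order H)) (Unique.allFin⁺ (order H)))

    length-charges : ∀ x → length (charges x) ≤ reachBound m (minorReach d)
    length-charges x =
      subst (_≤ reachBound m (minorReach d))
        (sym (length-map (x ,_) (wreach ρ sep (minorReach d) (top x))))
        (length-wreach ρ sep (minorReach d) (top x))

  separated⇒sparse : size H ≤ reachBound m (minorReach d) * order H
  separated⇒sparse = begin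
    size H
      ≤⟨ injection⇒length≤ charge edges! charge∈
           (λ p∈ q∈ → charge-injective (proj₁ (edge⁻ p∈)) (proj₁ (edge⁻ q∈))) ⟩
    length charged
      ≤⟨ length-concatMap-≤ charges length-charges (allFin (order H)) ⟩
    length (allFin (order H)) * reachBound m (minorReach d)
      ≡⟨ cong (_* reachBound m (minorReach d)) (length-tabulate {n = order H} id) ⟩
    order H * reachBound m (minorReach d)
      ≡⟨ *-comm (order H) _ ⟩
    reachBound m (minorReach d) * order H ∎
    where open ≤-Reasoning

theorem1p4 : ∀ {ℓ : Level} (C : Pred Graph ℓ) →
    BoundedExpansion C ⇔
    (∀ (r : ℕ) → ∃[ m ] (∀ (G : Graph) → C G → ∀ (v : Vertex G) → rank G r m v ≢ ∞))
theorem1p4 C = mk⇔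
  (λ (f , sparse) r → cutBound (f r) r , λ G G∈C → sparse⇒ranked G r (f r) (sparse r G G∈C))
  (λ ranked →
    -- Minors of depth `d` are controlled by ranks of radius `4d + 1`, enough to cross two adjacent
    -- branch sets.
    (λ d → reachBound (proj₁ (ranked (minorReach d))) (minorReach d)) ,
    λ d G G∈C H minor →
      let m , finite = ranked (minorReach d)
          ρ , sep    = ranked⇒separated G (minorReach d) m (finite G G∈C)
      in separated⇒sparse minor ρ sep)
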